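{- Let $\mathcal{M}=(E,\mathcal{T})$ be a simple oriented matroid that is not acyclic, on ground set $E$, with set of topes $\mathcal{T}$. Let $\#\mathbf{K}_3^{\ast}(\mathcal{M})$ and $\#\mathbf{A}_3^{\ast}(\mathcal{M})$ be the numbers of tope committees and of tope anti-committees of cardinality $3$ for $\mathcal{M}$, respectively, and let $\widehat{L}$ be the lattice of convex subsets of $E$ augmented by the greatest element $\hat{1}:=E$. Then $$\#\mathbf{K}_3^{\ast}(\mathcal{M})=\#\mathbf{A}_3^{\ast}(\mathcal{M})=\sum_{\substack{\{A_1,A_2,A_3\}\subset \widehat{L}-\{\hat{0},\hat{1}\}:\\ A_1\wedge A_2=A_1\wedge A_3=A_2\wedge A_3=\hat{0}}}\ \prod_{k\in\{1,2,3\}}\Bigl|\mathcal{T}_{\mathrm{ex}(A_k)}^+\cap\bigl(-\mathcal{T}_{\mathrm{ex}(\mathrm{conv}(E-A_k))}^+\bigr)\Bigr|,$$ where the sum is over unordered triples (3-element subsets) $\{A_1,A_2,A_3\}$.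
   Context: An oriented matroid is called simple here if it has no loops, no parallel elements and no antiparallel elements. Topes are the maximal covectors, regarded as sign vectors $T\in\{+,-\}^E$. $\mathcal{M}$ is acyclic if it has the tope all of whose components are $+$. For a set of sign vectors $\mathcal{F}$, $-\mathcal{F}:=\{ -F: F\in\mathcal{F}\}$. For $e\in E$, the positive halfspace is $\mathcal{T}_e^+:=\{T\in\mathcal{T}: T(e)=+\}$, and for $B\subseteq E$, $\mathcal{T}_B^+:=\bigcap_{b\in B}\mathcal{T}_b^+$. A tope committee for $\mathcal{M}$ is a subset $\mathcal{K}^{\ast}\subset\mathcal{T}$ such that $|\mathcal{T}_e^+\cap\mathcal{K}^{\ast}|>\frac12|\mathcal{K}^{\ast}|$ for every $e\in E$. A tope anti-committee for $\mathcal{M}$ is a subset $\mathcal{A}^{\ast}\subset\mathcal{T}$ such that $-\mathcal{A}^{\ast}$ is a tope committee for $\mathcal{M}$. $\mathbf{K}_k^{\ast}(\mathcal{M})$ and $\mathbf{A}_k^{\ast}(\mathcal{M})$ denote the families of all tope committees and anti-committees of cardinality $k$; $\#$ denotes the number of sets in a family. A subset $A\subset E$ is acyclic if the restriction of $\mathcal{M}$ to $A$ is an acyclic oriented matroid. The convex hull $\mathrm{conv}(A)$ of an acyclic set $A$ is the set of all $b\in E$ such that for every covector $F$ of $\mathcal{M}$, if $F(a)=+$ for all $a\in A$ then $F(b)=+$. An acyclic set $A$ is convex if $\mathrm{conv}(A)=A$; its set of extreme points is $\mathrm{ex}(A):=\{a\in A: a\notin\mathrm{conv}(A-\{a\})\}$.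 If $H\subseteq E$ is not acyclic, one sets $\mathrm{conv}(H):=E$, and one sets $\mathrm{ex}(E):=E$. The convex subsets of $E$ ordered by inclusion form a meet-semilattice with least element $\hat{0}$ the empty set; $\widehat{L}$ is this poset with a greatest element $\hat{1}:=E$ adjoined, and $\wedge$ denotes its meet. -}

module Defs where

open import Data.Bool.Base using (true; false)
open import Data.Fin.Base using (Fin)
import Data.Fin.Properties as Fin
open import Data.Fin.Subset
  using (Subset; inside; outside; _∈_; _⊆_; ⊥; ⊤; _-_; ∣_∣)
import Data.Fin.Subset.Properties as Subset
open import Data.List.Base as List
  using (List; []; _∷_; _++_; filter; length; cartesianProductWith)
open import Data.List.Membership.Propositional renaming (_∈_ to _∈ˡ_; lose to loseˡ)
open import Data.List.Membership.Propositional.Properties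
  using (∈-cartesianProductWith⁺)
open import Data.List.Relation.Unary.Any as Any using (here; there)
open import Data.List.Relation.Unary.All as All using ()
open import Data.Nat.Base using (ℕ; zero; suc; _*_; _<_)
import Data.Nat.Properties as ℕ
open import Data.Product.Base using (∃; _×_; _,_)
open import Data.Sum.Base using (_⊎_)
open import Data.Vec.Base as Vec
  using (Vec; []; _∷_; lookup; replicate; zipWith; tabulate; count)
import Data.Vec.Properties as Vec
import Data.Vec.Relation.Unary.All as VecAll
import Data.Vec.Relation.Unary.AllPairs as VecAllPairs
open import Data.Vec.Relation.Unary.Unique.Propositional using (Unique)
open import Data.Bool.Properties using () renaming (_≟_ to _≟ᵇ_)
open import Function.Base using (_∘_)
open import Level using (0ℓ)
open import Relation.Binary.Definitions using (DecidableEquality)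
open import Relation.Binary.PropositionalEquality.Core
  using (_≡_; _≢_; refl; sym; trans; cong; cong₂; subst)
open import Relation.Nullary.Decidable.Core
  using (Dec; yes; no; does; map′; _×-dec_; _⊎-dec_; _→-dec_; ¬?)
open import Relation.Nullary.Negation.Core using (¬_)
open import Relation.Unary using (Pred; Decidable)

private
  variable
    A : Set
    k n : ℕ

-- Data.Sign lacks the sign 0.
data Sign : Set where
  ⊕ ⊖ 𝟎 : Sign

infix 4 _≟ˢ_
_≟ˢ_ : DecidableEquality Sign
⊕ ≟ˢ ⊕ = yes refl
⊕ ≟ˢ ⊖ = no λ ()
⊕ ≟ˢ 𝟎 = no λ ()
⊖ ≟ˢ ⊕ = no λ ()
⊖ ≟ˢ ⊖ = yes refl
⊖ ≟ˢ 𝟎 = no λ ()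
𝟎 ≟ˢ ⊕ = no λ ()
𝟎 ≟ˢ ⊖ = no λ ()
𝟎 ≟ˢ 𝟎 = yes refl

opposite : Sign → Sign
opposite ⊕ = ⊖
opposite ⊖ = ⊕
opposite 𝟎 = 𝟎

opposite-involutive : ∀ s → opposite (opposite s) ≡ s
opposite-involutive ⊕ = refl
opposite-involutive ⊖ = refl
opposite-involutive 𝟎 = refl

SignVector : ℕ → Set
SignVector = Vec Sign

infix 4 _≟ᵛ_
_≟ᵛ_ : DecidableEquality (SignVector n)
_≟ᵛ_ = Vec.≡-dec _≟ˢ_

infix 8 −_
−_ : SignVector n → SignVector n
−_ = Vec.map opposite

−-involutive : (X : SignVector n) → − (− X) ≡ X
−-involutive []      = refl
−-involutive (s ∷ X) = cong₂ _∷_ (opposite-involutive s) (−-involutive X)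

infixr 7 _◦ˢ_ _◦_
_◦ˢ_ : Sign → Sign → Sign
⊕ ◦ˢ _ = ⊕
⊖ ◦ˢ _ = ⊖
𝟎 ◦ˢ t = t

_◦_ : SignVector n → SignVector n → SignVector n
_◦_ = zipWith _◦ˢ_

-- f lies in the separation set S(X , Y).
Separates : SignVector n → SignVector n → Fin n → Set
Separates X Y f = lookup X f ≢ 𝟎 × lookup X f ≡ opposite (lookup Y f)

infix 4 _≼_ _≼?_
_≼_ : SignVector n → SignVector n → Set
X ≼ Y = ∀ e → lookup X e ≡ 𝟎 ⊎ lookup X e ≡ lookup Y e

_≼?_ : (X Y : SignVector n) → Dec (X ≼ Y)
X ≼? Y = Fin.all? λ e → (lookup X e ≟ˢ 𝟎) ⊎-dec (lookup X e ≟ˢ lookup Y e)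

-- An oriented matroid on the ground set E = Fin n, given by its covectors.
-- Classically every family of sign vectors on a finite set is decidable;
-- decidability is what makes the counts below well defined.
record OrientedMatroid (n : ℕ) : Set₁ where
  field
    Covector    : Pred (SignVector n) 0ℓ
    covector?   : Decidable Covector
    zeroVector  : Covector (replicate n 𝟎)
    symmetry    : ∀ {X} → Covector X → Covector (− X)
    composition : ∀ {X Y} → Covector X → Covector Y → Covector (X ◦ Y)
    elimination : ∀ {X Y} → Covector X → Covector Y → ∀ e → Separates X Y e →
                  ∃ λ Z → Covector Z × lookup Z e ≡ 𝟎 ×
                    (∀ f → ¬ Separates X Y f → lookup Z f ≡ lookup (X ◦ Y) f)

open OrientedMatroid public

vectors : List A → ∀ n → List (Vec A n)
vectors xs zero    = [] ∷ []
vectors xs (suc n) = cartesianProductWith _∷_ xs (vectors xs n)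

∈-vectors : ∀ {xs : List A} → (∀ x → x ∈ˡ xs) → (v : Vec A n) → v ∈ˡ vectors xs n
∈-vectors x∈ []      = here refl
∈-vectors x∈ (x ∷ v) = ∈-cartesianProductWith⁺ _∷_ (x∈ x) (∈-vectors x∈ v)

signVectors : ∀ n → List (SignVector n)
signVectors = vectors (⊕ ∷ ⊖ ∷ 𝟎 ∷ [])

∈-signVectors : (X : SignVector n) → X ∈ˡ signVectors n
∈-signVectors = ∈-vectors λ where
  ⊕ → here refl
  ⊖ → there (here refl)
  𝟎 → there (there (here refl))

subsets : ∀ n → List (Subset n)
subsets = vectors (inside ∷ outside ∷ [])

∈-subsets : (B : Subset n) → B ∈ˡ subsets n
∈-subsets = ∈-vectors λ where
  true  → here refl
  false → there (here refl)

-- If xs has no repetitions, each k-element subset of xs occurs exactly once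
-- in combinations k xs, listed in the order of xs.
combinations : ∀ k → List A → List (Vec A k)
combinations zero    xs       = [] ∷ []
combinations (suc k) []       = []
combinations (suc k) (x ∷ xs) =
  List.map (x ∷_) (combinations k xs) ++ combinations (suc k) xs

private
  all-enum? : ∀ {xs : List A} → (∀ x → x ∈ˡ xs) →
              {P : Pred A 0ℓ} → Decidable P → Dec (∀ x → P x)
  all-enum? {xs = xs} x∈ P? =
    map′ (λ all x → All.lookup all (x∈ x)) (λ f → All.universal f xs) (All.all? P? xs)

  any-enum? : ∀ {xs : List A} → (∀ x → x ∈ˡ xs) →
              {P : Pred A 0ℓ} → Decidable P → Dec (∃ P)
  any-enum? {xs = xs} x∈ P? =
    map′ Any.satisfied (λ (x , px) → loseˡ (x∈ x) px) (Any.any? P? xs)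

allSignVector? : {P : Pred (SignVector n) 0ℓ} → Decidable P → Dec (∀ X → P X)
allSignVector? = all-enum? ∈-signVectors

anySignVector? : {P : Pred (SignVector n) 0ℓ} → Decidable P → Dec (∃ P)
anySignVector? = any-enum? ∈-signVectors

allSubset? : {P : Pred (Subset n) 0ℓ} → Decidable P → Dec (∀ B → P B)
allSubset? = all-enum? ∈-subsets

infix 4 _≟ᵖ_
_≟ᵖ_ : DecidableEquality (Subset n)
_≟ᵖ_ = Vec.≡-dec _≟ᵇ_

card : {𝓕 : Pred (SignVector n) 0ℓ} → Decidable 𝓕 → ℕ
card {n = n} 𝓕? = length (filter 𝓕? (signVectors n))

comprehension : {P : Pred (Fin n) 0ℓ} → Decidable P → Subset n
comprehension P? = tabulate (does ∘ P?)

Maximal : Pred (SignVector n) 0ℓ → Pred (SignVector n) 0ℓ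
Maximal 𝓛 T = 𝓛 T × (∀ Y → 𝓛 Y → T ≼ Y → T ≡ Y)

maximal? : {𝓛 : Pred (SignVector n) 0ℓ} → Decidable 𝓛 → Decidable (Maximal 𝓛)
maximal? 𝓛? T =
  𝓛? T ×-dec allSignVector? λ Y → 𝓛? Y →-dec (T ≼? Y →-dec T ≟ᵛ Y)

AcyclicFamily : Pred (SignVector n) 0ℓ → Set
AcyclicFamily {n} 𝓛 = Maximal 𝓛 (replicate n ⊕)

restrictVector : SignVector n → (B : Subset n) → SignVector ∣ B ∣
restrictVector []      []            = []
restrictVector (s ∷ X) (inside  ∷ B) = s ∷ restrictVector X B
restrictVector (s ∷ X) (outside ∷ B) = restrictVector X B

-- The covectors of the restriction to B, whose ground set is B renumbered
-- increasingly as Fin ∣ B ∣.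
Restriction : Pred (SignVector n) 0ℓ → (B : Subset n) → Pred (SignVector ∣ B ∣) 0ℓ
Restriction 𝓛 B X = ∃ λ F → 𝓛 F × X ≡ restrictVector F B

restriction? : {𝓛 : Pred (SignVector n) 0ℓ} → Decidable 𝓛 →
               (B : Subset n) → Decidable (Restriction 𝓛 B)
restriction? 𝓛? B X = anySignVector? λ F → 𝓛? F ×-dec X ≟ᵛ restrictVector F B

−ᶠ : Pred (SignVector n) 0ℓ → Pred (SignVector n) 0ℓ
−ᶠ 𝓕 T = ∃ λ F → 𝓕 F × T ≡ − F

−ᶠ? : {𝓕 : Pred (SignVector n) 0ℓ} → Decidable 𝓕 → Decidable (−ᶠ 𝓕)
−ᶠ? {𝓕 = 𝓕} 𝓕? T = map′
  (λ p → − T , p , sym (−-involutive T))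
  (λ (F , p , T≡) → subst 𝓕 (sym (trans (cong −_ T≡) (−-involutive F))) p)
  (𝓕? (− T))

0̂ 1̂ : Subset n
0̂ = ⊥
1̂ = ⊤

module _ (M : OrientedMatroid n) where

  Loop : Fin n → Set
  Loop e = ∀ X → Covector M X → lookup X e ≡ 𝟎

  Parallel Antiparallel : Fin n → Fin n → Set
  Parallel     e f = ∀ X → Covector M X → lookup X e ≡ lookup X f
  Antiparallel e f = ∀ X → Covector M X → lookup X e ≡ opposite (lookup X f)

  record Simple : Set where
    field
      noLoops        : ∀ e → ¬ Loop e
      noParallel     : ∀ e f → e ≢ f → ¬ Parallel e f
      noAntiparallel : ∀ e f → e ≢ f → ¬ Antiparallel e f

  Tope : Pred (SignVector n) 0ℓ
  Tope = Maximal (Covector M)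

  tope? : Decidable Tope
  tope? = maximal? (covector? M)

  Acyclic : Set
  Acyclic = AcyclicFamily (Covector M)

  𝒯⁺ : Fin n → Pred (SignVector n) 0ℓ
  𝒯⁺ e T = Tope T × lookup T e ≡ ⊕

  𝒯⁺? : ∀ e → Decidable (𝒯⁺ e)
  𝒯⁺? e T = tope? T ×-dec lookup T e ≟ˢ ⊕

  -- The conjunct Tope T makes the empty intersection 𝒯⁺⋂ ⊥ all of 𝒯.
  𝒯⁺⋂ : Subset n → Pred (SignVector n) 0ℓ
  𝒯⁺⋂ B T = Tope T × (∀ b → b ∈ B → 𝒯⁺ b T)

  𝒯⁺⋂? : ∀ B → Decidable (𝒯⁺⋂ B)
  𝒯⁺⋂? B T = tope? T ×-dec Fin.all? λ b → b Subset.∈? B →-dec 𝒯⁺? b T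

  -- A set of k topes is represented by a repetition-free vector listing it;
  -- the predicates below do not depend on the order of the listing.
  TopeSet : Pred (Vec (SignVector n) k) 0ℓ
  TopeSet K = VecAll.All Tope K × Unique K

  topeSet? : Decidable (TopeSet {k})
  topeSet? K =
    VecAll.all? tope? K ×-dec VecAllPairs.allPairs? (λ S T → ¬? (S ≟ᵛ T)) K

  TopeCommittee : Pred (Vec (SignVector n) k) 0ℓ
  TopeCommittee {k} K = TopeSet K × (∀ e → k < 2 * count (𝒯⁺? e) K)

  topeCommittee? : Decidable (TopeCommittee {k})
  topeCommittee? {k} K =
    topeSet? K ×-dec Fin.all? λ e → k ℕ.<? 2 * count (𝒯⁺? e) K

  TopeAntiCommittee : Pred (Vec (SignVector n) k) 0ℓ
  TopeAntiCommittee A = TopeSet A × TopeCommittee (Vec.map −_ A)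

  topeAntiCommittee? : Decidable (TopeAntiCommittee {k})
  topeAntiCommittee? A = topeSet? A ×-dec topeCommittee? (Vec.map −_ A)

  #𝐊 #𝐀 : ℕ → ℕ
  #𝐊 k = length (filter topeCommittee? (combinations k (signVectors n)))
  #𝐀 k = length (filter topeAntiCommittee? (combinations k (signVectors n)))

  AcyclicSet : Pred (Subset n) 0ℓ
  AcyclicSet A = AcyclicFamily (Restriction (Covector M) A)

  acyclicSet? : Decidable AcyclicSet
  acyclicSet? A = maximal? (restriction? (covector? M) A) (replicate _ ⊕)

  InHull : Subset n → Pred (Fin n) 0ℓ
  InHull A b =
    ∀ F → Covector M F → (∀ a → a ∈ A → lookup F a ≡ ⊕) → lookup F b ≡ ⊕

  inHull? : ∀ A → Decidable (InHull A)
  inHull? A b = allSignVector? λ F → covector? M F →-dec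
    ((Fin.all? λ a → a Subset.∈? A →-dec lookup F a ≟ˢ ⊕) →-dec lookup F b ≟ˢ ⊕)

  conv : Subset n → Subset n
  conv A with acyclicSet? A
  ... | yes _ = comprehension (inHull? A)
  ... | no  _ = ⊤

  Convex : Pred (Subset n) 0ℓ
  Convex A = AcyclicSet A × conv A ≡ A

  convex? : Decidable Convex
  convex? A = acyclicSet? A ×-dec conv A ≟ᵖ A

  -- The second clause is the convention ex(E) := E for non-acyclic E; its
  -- value at other non-acyclic sets is arbitrary.
  ex : Subset n → Subset n
  ex A with acyclicSet? A
  ... | yes _ = comprehension λ a →
                  a Subset.∈? A ×-dec ¬? (a Subset.∈? conv (A - a))
  ... | no  _ = ⊤

  -- 1̂ := E is a new element precisely because M is not acyclic.
  L̂ : Pred (Subset n) 0ℓ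
  L̂ A = Convex A ⊎ A ≡ 1̂

  l̂? : Decidable L̂
  l̂? A = convex? A ⊎-dec A ≟ᵖ 1̂

  -- C is the meet A ∧ B in L̂.
  IsMeet : (A B C : Subset n) → Set
  IsMeet A B C = L̂ C × C ⊆ A × C ⊆ B × (∀ D → L̂ D → D ⊆ A → D ⊆ B → D ⊆ C)

  isMeet? : ∀ A B C → Dec (IsMeet A B C)
  isMeet? A B C = l̂? C ×-dec C Subset.⊆? A ×-dec C Subset.⊆? B ×-dec
    allSubset? λ D → l̂? D →-dec (D Subset.⊆? A →-dec (D Subset.⊆? B →-dec D Subset.⊆? C))

  L̂-proper : Pred (Subset n) 0ℓ
  L̂-proper A = L̂ A × A ≢ 0̂ × A ≢ 1̂

  l̂-proper? : Decidable L̂-proper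
  l̂-proper? A = l̂? A ×-dec ¬? (A ≟ᵖ 0̂) ×-dec ¬? (A ≟ᵖ 1̂)

  MeetsAreZero : Pred (Vec (Subset n) 3) 0ℓ
  MeetsAreZero (A₁ ∷ A₂ ∷ A₃ ∷ []) =
    IsMeet A₁ A₂ 0̂ × IsMeet A₁ A₃ 0̂ × IsMeet A₂ A₃ 0̂

  meetsAreZero? : Decidable MeetsAreZero
  meetsAreZero? (A₁ ∷ A₂ ∷ A₃ ∷ []) =
    isMeet? A₁ A₂ 0̂ ×-dec isMeet? A₁ A₃ 0̂ ×-dec isMeet? A₂ A₃ 0̂

  admissibleTriples : List (Vec (Subset n) 3)
  admissibleTriples =
    filter meetsAreZero? (combinations 3 (filter l̂-proper? (subsets n)))

{-# OPTIONS --safe #-}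

-- Let ρ A (negativeOn A below) be the vector that is ⊖ on A and ⊕ off A.  Each
-- tope is ρ A for a unique A, and three topes form a committee exactly when
-- their negative parts are pairwise disjoint.  Negative parts of topes are
-- convex, nonempty and proper, and for convex sets disjointness is the
-- vanishing of the meet.  The factor of A in the sum counts the topes that are
-- ⊕ on ex A and ⊖ on ex (conv (E − A)).  By anti-exchange an acyclic set lies
-- in the hull of its extreme points, so the only candidate is − ρ A and the
-- factor is 1 if ρ A is a tope and 0 otherwise.  Anti-committees match
-- committees under negation, which only reorders the list of sign vectors.

module Submission where

open import Defs
open import Data.Bool.Base using (Bool; true; false; if_then_else_)
open import Data.Empty using (⊥-elim)
open import Data.Fin.Base using (Fin)
import Data.Fin.Properties as Fin
open import Data.Fin.Subset
  using (Subset; inside; outside; _∈_; _∉_; _⊆_; _⊂_; ⊤; _-_; _∩_; ⁅_⁆; ∁)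
open import Data.Fin.Subset.Induction using (Acc; acc; ⊂-wellFounded)
import Data.Fin.Subset.Properties as Subset
open import Data.List.Base using (List; []; _∷_; _++_; filter; length; map; allFin)
open import Data.List.Membership.Propositional renaming (_∈_ to _∈ˡ_) using ()
open import Data.List.Membership.Propositional.Properties
  using (∈-filter⁺; ∈-filter⁻; ∈-map⁺; ∈-map⁻; ∈-allFin)
open import Data.List.Membership.Propositional.Properties.WithK using (unique∧set⇒bag)
open import Data.List.Properties using (map-++; map-∘; map-cong)
open import Data.List.Relation.Binary.BagAndSetEquality using (∼bag⇒↭)
open import Data.List.Relation.Binary.Permutation.Propositional as ↭ using (_↭_)
open import Data.List.Relation.Binary.Permutation.Propositional.Properties
  using (↭-length)
open import Data.List.Relation.Unary.All as ListAll using ([]; _∷_)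
import Data.List.Relation.Unary.AllPairs as ListAllPairs
open import Data.List.Relation.Unary.Any using (here; there)
import Data.List.Relation.Unary.Unique.Propositional as List
import Data.List.Relation.Unary.Unique.Propositional.Properties as ListUnique
open import Data.Nat.Base using (ℕ; zero; suc; _+_; _*_; _<_; s≤s)
open import Data.Nat.ListAction using (sum; product)
open import Data.Nat.ListAction.Properties using (sum-++)
import Data.Nat.Properties as ℕ
open import Data.Product.Base using (∃; _×_; _,_; proj₁; proj₂)
open import Data.Sum.Base using (_⊎_; inj₁; inj₂; [_,_]′)
open import Data.Vec.Base as Vec
  using (Vec; []; _∷_; lookup; replicate; tabulate; count; toList)
open import Data.Vec.Properties
  using (lookup-map; lookup-replicate; lookup-zipWith; lookup∘tabulate;
         tabulate∘lookup; tabulate-cong; []=⇒lookup; lookup⇒[]=; ∷-injective)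
import Data.Vec.Relation.Unary.All as VecAll
import Data.Vec.Relation.Unary.All.Properties as VecAll
open import Data.Vec.Relation.Unary.AllPairs as VecAllPairs using ([]; _∷_)
open import Data.Vec.Relation.Unary.Unique.Propositional using (Unique)
open import Function.Base using (_∘_; id)
open import Function.Bundles using (_⇔_; mk⇔; Equivalence)
open import Level using (0ℓ)
open import Relation.Binary.PropositionalEquality.Core
  using (_≡_; _≢_; refl; sym; trans; cong; cong₂; subst; ≢-sym)
open import Relation.Binary.PropositionalEquality.Properties using (module ≡-Reasoning)
open import Relation.Nullary.Decidable using (does-⇔; dec-true; dec-false; decidable-stable)
open import Relation.Nullary.Decidable.Core
  using (Dec; yes; no; does; ¬?; _×-dec_)
open import Relation.Nullary.Negation.Core using (¬_; contradiction)
open import Relation.Unary using (Pred; Decidable)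
open import Relation.Unary.Properties using (_∩?_)

open Equivalence using (to; from)

private
  variable
    A B : Set
    k n : ℕ

-- Sums over combinations

𝟙 : {P : Pred A 0ℓ} → Decidable P → A → ℕ
𝟙 P? x = if does (P? x) then 1 else 0

length-filter≡sum : {P : Pred A 0ℓ} (P? : Decidable P) (xs : List A) →
                    length (filter P? xs) ≡ sum (map (𝟙 P?) xs)
length-filter≡sum P? []       = refl
length-filter≡sum P? (x ∷ xs) with does (P? x)
... | true  = cong suc (length-filter≡sum P? xs)
... | false = length-filter≡sum P? xs

sum-map-filter : {P : Pred A 0ℓ} (P? : Decidable P) (f : A → ℕ) (xs : List A) →
                 sum (map f (filter P? xs)) ≡ sum (map (λ x → 𝟙 P? x * f x) xs)
sum-map-filter P? f []       = refl
sum-map-filter P? f (x ∷ xs) with does (P? x)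
... | true  = cong₂ _+_ (sym (ℕ.*-identityˡ (f x))) (sum-map-filter P? f xs)
... | false = sum-map-filter P? f xs

𝟙-cong : {P : Pred A 0ℓ} {Q : Pred B 0ℓ} (P? : Decidable P) (Q? : Decidable Q) →
         ∀ {x y} → P x ⇔ Q y → 𝟙 P? x ≡ 𝟙 Q? y
𝟙-cong P? Q? {x} {y} P⇔Q =
  cong (λ b → if b then 1 else 0) (does-⇔ P⇔Q (P? x) (Q? y))

-- Committee counts and the sum over triples are all brought to this form, in which `k`-subsets of
-- different lists can be compared by induction.
combSum : (Vec A k → ℕ) → List A → ℕ
combSum {k = k} f xs = sum (map f (combinations k xs))

-- A combination either uses the head `x` or avoids it; the inductions on `combSum` below rest on
-- this split.
combSum-∷ : (f : Vec A (suc k) → ℕ) (x : A) (xs : List A) →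
            combSum f (x ∷ xs) ≡ combSum (f ∘ (x ∷_)) xs + combSum f xs
combSum-∷ {k = k} f x xs = begin
  sum (map f (map (x ∷_) c ++ d))            ≡⟨ cong sum (map-++ f (map (x ∷_) c) d) ⟩
  sum (map f (map (x ∷_) c) ++ map f d)      ≡⟨ sum-++ (map f (map (x ∷_) c)) (map f d) ⟩
  sum (map f (map (x ∷_) c)) + sum (map f d) ≡⟨ cong (λ s → sum s + sum (map f d)) (map-∘ c) ⟨
  combSum (f ∘ (x ∷_)) xs + combSum f xs     ∎
  where
  open ≡-Reasoning
  c = combinations k xs
  d = combinations (suc k) xs

-- Combinations draw their entries from `xs`, so `f` and `g` are compared only on vectors whose
-- entries satisfy `P`.
combSum-cong : {P : Pred A 0ℓ} {f g : Vec A k → ℕ} →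
               (∀ v → VecAll.All P v → f v ≡ g v) →
               ∀ {xs} → ListAll.All P xs → combSum f xs ≡ combSum g xs
combSum-cong {k = zero}  f≗g _  = cong (_+ 0) (f≗g [] VecAll.[])
combSum-cong {k = suc k} f≗g [] = refl
combSum-cong {k = suc k} {f = f} {g} f≗g {x ∷ xs} (px ∷ pxs) = begin
  combSum f (x ∷ xs)                      ≡⟨ combSum-∷ f x xs ⟩
  combSum (f ∘ (x ∷_)) xs + combSum f xs  ≡⟨ cong₂ _+_
      (combSum-cong (λ v pv → f≗g (x ∷ v) (px VecAll.∷ pv)) pxs) (combSum-cong f≗g pxs) ⟩
  combSum (g ∘ (x ∷_)) xs + combSum g xs  ≡⟨ combSum-∷ g x xs ⟨
  combSum g (x ∷ xs)                      ∎
  where open ≡-Reasoning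

combSum-zero : {f : Vec A k → ℕ} → (∀ v → f v ≡ 0) → ∀ xs → combSum f xs ≡ 0
combSum-zero {k = zero}          f≗0 xs       = cong (_+ 0) (f≗0 [])
combSum-zero {k = suc k}         f≗0 []       = refl
combSum-zero {k = suc k} {f = f} f≗0 (x ∷ xs) = trans (combSum-∷ f x xs)
  (cong₂ _+_ (combSum-zero (f≗0 ∘ (x ∷_)) xs) (combSum-zero f≗0 xs))

combSum-map : (f : Vec B k → ℕ) (g : A → B) (xs : List A) →
              combSum f (map g xs) ≡ combSum (f ∘ Vec.map g) xs
combSum-map {k = zero}  f g xs       = refl
combSum-map {k = suc k} f g []       = refl
combSum-map {k = suc k} f g (x ∷ xs) = begin
  combSum f (g x ∷ map g xs)
    ≡⟨ combSum-∷ f (g x) (map g xs) ⟩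
  combSum (f ∘ (g x ∷_)) (map g xs) + combSum f (map g xs)
    ≡⟨ cong₂ _+_ (combSum-map (f ∘ (g x ∷_)) g xs) (combSum-map f g xs) ⟩
  combSum (f ∘ Vec.map g ∘ (x ∷_)) xs + combSum (f ∘ Vec.map g) xs
    ≡⟨ combSum-∷ (f ∘ Vec.map g) x xs ⟨
  combSum (f ∘ Vec.map g) (x ∷ xs)
    ∎
  where open ≡-Reasoning

-- Filtering loses only combinations with an entry outside `P`, and these contribute 0.
combSum-filter : {P : Pred A 0ℓ} (P? : Decidable P) {f : Vec A k → ℕ} →
                 (∀ v → ¬ VecAll.All P v → f v ≡ 0) →
                 ∀ xs → combSum f (filter P? xs) ≡ combSum f xs
combSum-filter {k = zero}  P? f≗0 xs = refl
combSum-filter {k = suc k} P? f≗0 [] = refl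
combSum-filter {k = suc k} P? {f} f≗0 (x ∷ xs) with P? x
... | yes px = begin
  combSum f (x ∷ filter P? xs)
    ≡⟨ combSum-∷ f x (filter P? xs) ⟩
  combSum (f ∘ (x ∷_)) (filter P? xs) + combSum f (filter P? xs)
    ≡⟨ cong₂ _+_ (combSum-filter P? (λ v ¬pv → f≗0 (x ∷ v) (¬pv ∘ VecAll.tail)) xs)
                 (combSum-filter P? f≗0 xs) ⟩
  combSum (f ∘ (x ∷_)) xs + combSum f xs
    ≡⟨ combSum-∷ f x xs ⟨
  combSum f (x ∷ xs)
    ∎
  where open ≡-Reasoning
... | no ¬px = begin
  combSum f (filter P? xs)
    ≡⟨ combSum-filter P? f≗0 xs ⟩
  combSum f xs
    ≡⟨ cong (_+ combSum f xs)
            (combSum-zero (λ v → f≗0 (x ∷ v) (¬px ∘ VecAll.head)) xs) ⟨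
  combSum (f ∘ (x ∷_)) xs + combSum f xs
    ≡⟨ combSum-∷ f x xs ⟨
  combSum f (x ∷ xs)
    ∎
  where open ≡-Reasoning

infix 4 _⇄_
data _⇄_ {A : Set} : Vec A k → Vec A k → Set where
  swap : ∀ x y (v : Vec A k) → x ∷ y ∷ v ⇄ y ∷ x ∷ v
  prep : ∀ x {v w : Vec A k} → v ⇄ w → x ∷ v ⇄ x ∷ w

⇄-sym : {v w : Vec A k} → v ⇄ w → w ⇄ v
⇄-sym (swap x y v) = swap y x v
⇄-sym (prep x s)   = prep x (⇄-sym s)

-- Adjacent transpositions generate the symmetric group.
Symmetric : (Vec A k → ℕ) → Set
Symmetric f = ∀ {v w} → v ⇄ w → f v ≡ f w

-- Reordering the list permutes the entries inside each combination, which a symmetric `f` does not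
-- notice. The induction follows the derivation of the permutation.
combSum-↭ : {f : Vec A k → ℕ} → Symmetric f →
            ∀ {xs ys} → xs ↭ ys → combSum f xs ≡ combSum f ys
combSum-↭ {k = zero}  f-sym p    = refl
combSum-↭ {k = suc k} f-sym ↭.refl = refl
combSum-↭ {k = suc k} {f = f} f-sym (↭.prep {xs} {ys} x p) = begin
  combSum f (x ∷ xs)                      ≡⟨ combSum-∷ f x xs ⟩
  combSum (f ∘ (x ∷_)) xs + combSum f xs  ≡⟨ cong₂ _+_
      (combSum-↭ (f-sym ∘ prep x) p) (combSum-↭ f-sym p) ⟩
  combSum (f ∘ (x ∷_)) ys + combSum f ys  ≡⟨ combSum-∷ f x ys ⟨
  combSum f (x ∷ ys)                      ∎
  where open ≡-Reasoning
-- A combination of size one cannot contain both `x` and `y`, so commutativity of addition is enough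
-- here.
combSum-↭ {k = suc zero} {f = f} f-sym (↭.swap {xs} {ys} x y p) = begin
  f (x ∷ []) + (f (y ∷ []) + combSum f xs)  ≡⟨ ℕ.+-assoc (f (x ∷ [])) _ _ ⟨
  f (x ∷ []) + f (y ∷ []) + combSum f xs    ≡⟨ cong₂ _+_
      (ℕ.+-comm (f (x ∷ [])) _) (combSum-↭ f-sym p) ⟩
  f (y ∷ []) + f (x ∷ []) + combSum f ys    ≡⟨ ℕ.+-assoc (f (y ∷ [])) _ _ ⟩
  f (y ∷ []) + (f (x ∷ []) + combSum f ys)  ∎
  where open ≡-Reasoning
combSum-↭ {A = A} {k = suc (suc k)} {f = f} f-sym (↭.swap {xs} {ys} x y p) = begin
  combSum f (x ∷ y ∷ xs)             ≡⟨ expand x y xs ⟩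
  Σ₂ x y xs + (Σ₁ x xs + (Σ₁ y xs + combSum f xs))
                                     ≡⟨ cong₂ _+_
      -- The constant predicate `λ _ → A` holds at each entry `x` with `x` itself as witness, so the
      -- congruence applies to every vector.
      (trans (combSum-cong {P = λ _ → A} (λ v _ → f-sym (swap x y v)) (ListAll.universal id xs))
             (combSum-↭ (f-sym ∘ prep y ∘ prep x) p))
      (rotate (combSum-↭ (f-sym ∘ prep x) p) (combSum-↭ (f-sym ∘ prep y) p)
              (combSum-↭ f-sym p)) ⟩
  Σ₂ y x ys + (Σ₁ y ys + (Σ₁ x ys + combSum f ys))
                                     ≡⟨ expand y x ys ⟨
  combSum f (y ∷ x ∷ ys)             ∎
  where
  open ≡-Reasoning
  Σ₁ : A → List A → ℕ
  Σ₁ x = combSum (f ∘ (x ∷_))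
  Σ₂ : A → A → List A → ℕ
  Σ₂ x y = combSum (f ∘ (x ∷_) ∘ (y ∷_))
  -- The four summands belong to the combinations that use both `x` and `y`, only `x`, only `y`, and
  -- neither.
  expand : ∀ x y xs → combSum f (x ∷ y ∷ xs) ≡
           Σ₂ x y xs + (Σ₁ x xs + (Σ₁ y xs + combSum f xs))
  expand x y xs = begin
    combSum f (x ∷ y ∷ xs)
      ≡⟨ combSum-∷ f x (y ∷ xs) ⟩
    Σ₁ x (y ∷ xs) + combSum f (y ∷ xs)
      ≡⟨ cong₂ _+_ (combSum-∷ (f ∘ (x ∷_)) y xs) (combSum-∷ f y xs) ⟩
    Σ₂ x y xs + Σ₁ x xs + (Σ₁ y xs + combSum f xs)
      ≡⟨ ℕ.+-assoc (Σ₂ x y xs) _ _ ⟩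
    Σ₂ x y xs + (Σ₁ x xs + (Σ₁ y xs + combSum f xs))
      ∎
  rotate : ∀ {a a′ b b′ c c′} → a ≡ a′ → b ≡ b′ → c ≡ c′ → a + (b + c) ≡ b′ + (a′ + c′)
  rotate {a} {b = b} {c = c} refl refl refl = begin
    a + (b + c) ≡⟨ ℕ.+-assoc a b c ⟨
    a + b + c   ≡⟨ cong (_+ c) (ℕ.+-comm a b) ⟩
    b + a + c   ≡⟨ ℕ.+-assoc b a c ⟩
    b + (a + c) ∎
combSum-↭ {k = suc k} f-sym (↭.trans p q) = trans (combSum-↭ f-sym p) (combSum-↭ f-sym q)

All-resp-⇄ : {P : Pred A 0ℓ} {v w : Vec A k} → v ⇄ w → VecAll.All P v → VecAll.All P w
All-resp-⇄ (swap x y v) (px VecAll.∷ py VecAll.∷ pv) = py VecAll.∷ px VecAll.∷ pv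
All-resp-⇄ (prep x s)   (px VecAll.∷ pv)      = px VecAll.∷ All-resp-⇄ s pv

Unique-resp-⇄ : {v w : Vec A k} → v ⇄ w → Unique v → Unique w
Unique-resp-⇄ (swap x y v) ((x≢y VecAll.∷ x∉v) ∷ y∉v ∷ v!) =
  (≢-sym x≢y VecAll.∷ y∉v) ∷ x∉v ∷ v!
Unique-resp-⇄ (prep x s) (x∉v ∷ v!) = All-resp-⇄ s x∉v ∷ Unique-resp-⇄ s v!

count-resp-⇄ : {P : Pred A 0ℓ} (P? : Decidable P) {v w : Vec A k} →
               v ⇄ w → count P? v ≡ count P? w
count-resp-⇄ P? (swap x y v) with does (P? x) | does (P? y)
... | true  | true  = refl
... | true  | false = refl
... | false | true  = refl
... | false | false = refl
count-resp-⇄ P? (prep x s) =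
  cong (if does (P? x) then suc else id) (count-resp-⇄ P? s)

-- The inequality says that the count is at least 2, hence that at most one entry fails `P`, hence
-- that no two entries fail together.
count-majority : {P : Pred A 0ℓ} (P? : Decidable P) (x y z : A) →
                 3 < 2 * count P? (x ∷ y ∷ z ∷ []) ⇔
                 ((P x ⊎ P y) × (P x ⊎ P z) × (P y ⊎ P z))
count-majority P? x y z with P? x | P? y | P? z
-- For a count of 3 the inequality unfolds to `4 ≤ 6`; for a count of 2, in the next three clauses,
-- to `4 ≤ 4`.
... | yes p | yes q | yes _ = mk⇔ (λ _ → inj₁ p , inj₁ p , inj₁ q) λ _ → ℕ.m≤m+n 4 2
... | yes p | yes q | no  _ = mk⇔ (λ _ → inj₁ p , inj₁ p , inj₁ q) λ _ → ℕ.≤-refl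
... | yes p | no  _ | yes r = mk⇔ (λ _ → inj₁ p , inj₁ p , inj₂ r) λ _ → ℕ.≤-refl
... | no  _ | yes q | yes r = mk⇔ (λ _ → inj₂ q , inj₂ r , inj₁ q) λ _ → ℕ.≤-refl
... | yes _ | no ¬q | no ¬r =
  mk⇔ (λ { (s≤s (s≤s ())) }) λ (_ , _ , q⊎r) → ⊥-elim ([ ¬q , ¬r ]′ q⊎r)
... | no ¬p | yes _ | no ¬r =
  mk⇔ (λ { (s≤s (s≤s ())) }) λ (_ , p⊎r , _) → ⊥-elim ([ ¬p , ¬r ]′ p⊎r)
... | no ¬p | no ¬q | yes _ =
  mk⇔ (λ { (s≤s (s≤s ())) }) λ (p⊎q , _) → ⊥-elim ([ ¬p , ¬q ]′ p⊎q)
... | no ¬p | no ¬q | no  _ = mk⇔ (λ ()) λ (p⊎q , _) → ⊥-elim ([ ¬p , ¬q ]′ p⊎q)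

-- Sign vectors and subsets

-- Families are counted through lists, so bijections between them enter as permutations; for
-- repetition-free lists a comparison of membership yields one.
unique∧≋⇒↭ : {xs ys : List A} → List.Unique xs → List.Unique ys →
             (∀ x → x ∈ˡ xs ⇔ x ∈ˡ ys) → xs ↭ ys
unique∧≋⇒↭ xs! ys! xs≋ys = ∼bag⇒↭ (unique∧set⇒bag xs! ys! λ {x} → xs≋ys x)

vectors-unique : {xs : List A} → List.Unique xs → ∀ n → List.Unique (vectors xs n)
vectors-unique xs! zero    = [] ListAllPairs.∷ ListAllPairs.[]
vectors-unique xs! (suc n) =
  ListUnique.cartesianProductWith⁺ _∷_ ∷-injective xs! (vectors-unique xs! n)

signVectors-unique : ∀ n → List.Unique (signVectors n)
signVectors-unique = vectors-unique
  (((λ ()) ∷ (λ ()) ∷ []) ListAllPairs.∷ ((λ ()) ∷ []) ListAllPairs.∷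
   [] ListAllPairs.∷ ListAllPairs.[])

subsets-unique : ∀ n → List.Unique (subsets n)
subsets-unique = vectors-unique (((λ ()) ∷ []) ListAllPairs.∷ [] ListAllPairs.∷ ListAllPairs.[])

lookup-extensional : {v w : Vec A n} → (∀ i → lookup v i ≡ lookup w i) → v ≡ w
lookup-extensional {v = v} {w} v≗w =
  trans (sym (tabulate∘lookup v)) (trans (tabulate-cong v≗w) (tabulate∘lookup w))

−-injective : {X Y : SignVector n} → − X ≡ − Y → X ≡ Y
−-injective {X = X} {Y} eq =
  trans (sym (−-involutive X)) (trans (cong −_ eq) (−-involutive Y))

map−-signVectors-↭ : ∀ n → map −_ (signVectors n) ↭ signVectors n
map−-signVectors-↭ n = unique∧≋⇒↭
  (ListUnique.map⁺ −-injective (signVectors-unique n)) (signVectors-unique n)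
  λ X → mk⇔ (λ _ → ∈-signVectors X)
            (λ _ → subst (_∈ˡ map −_ (signVectors n)) (−-involutive X)
                         (∈-map⁺ −_ (∈-signVectors (− X))))

card≢0 : {P : Pred (SignVector n) 0ℓ} (P? : Decidable P) → card P? ≢ 0 → ∃ P
card≢0 {n} P? ≢0 with filter P? (signVectors n) in eq
... | []    = contradiction refl ≢0
... | X ∷ _ = X , proj₂ (∈-filter⁻ P? {xs = signVectors n} (subst (X ∈ˡ_) (sym eq) (here refl)))

card-singleton : {P : Pred (SignVector n) 0ℓ} (P? : Decidable P) {X : SignVector n} →
                 P X → (∀ Y → P Y → Y ≡ X) → card P? ≡ 1
card-singleton {n} P? {X} pX unique = ↭-length (unique∧≋⇒↭
  (ListUnique.filter⁺ P? (signVectors-unique n)) ([] ListAllPairs.∷ ListAllPairs.[])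
  λ Y → mk⇔
    (λ Y∈ → here (unique Y (proj₂ (∈-filter⁻ P? {xs = signVectors n} Y∈))))
    (λ { (here refl) → ∈-filter⁺ P? (∈-signVectors Y) pX }))

∈-comprehension : {P : Pred (Fin n) 0ℓ} (P? : Decidable P) (e : Fin n) →
                  e ∈ comprehension P? ⇔ P e
∈-comprehension P? e = mk⇔
  (λ e∈ → witness (P? e) (trans (sym (lookup∘tabulate (does ∘ P?) e)) ([]=⇒lookup e∈)))
  (λ pe → lookup⇒[]= e _ (trans (lookup∘tabulate (does ∘ P?) e) (dec-true (P? e) pe)))
  where
  witness : {Q : Set} (Q? : Dec Q) → does Q? ≡ true → Q
  witness (yes q) _ = q

x∈p-y⇒x≢y : {p : Subset n} {x y : Fin n} → x ∈ p - y → x ≢ y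
x∈p-y⇒x≢y {p = _ ∷ p} {Fin.zero}  {Fin.zero}  ()
x∈p-y⇒x≢y {p = _ ∷ p} {Fin.suc x} {Fin.suc y} (Vec.there x∈) refl = x∈p-y⇒x≢y {p = p} x∈ refl

Positive : SignVector n → Pred (Subset n) 0ℓ
Positive X B = ∀ b → b ∈ B → lookup X b ≡ ⊕

-- Acyclicity of `B` speaks of vectors on the renumbered ground set `Fin ∣ B ∣`; this and its
-- converse translate it into positivity of a covector at the elements of `B`.
restrictVector-⊕⁺ : (X : SignVector n) (B : Subset n) → Positive X B →
                    replicate _ ⊕ ≡ restrictVector X B
restrictVector-⊕⁺ []      []            pos = refl
restrictVector-⊕⁺ (s ∷ X) (inside  ∷ B) pos = cong₂ _∷_
  (sym (pos Fin.zero Vec.here)) (restrictVector-⊕⁺ X B λ b b∈ → pos (Fin.suc b) (Vec.there b∈))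
restrictVector-⊕⁺ (s ∷ X) (outside ∷ B) pos =
  restrictVector-⊕⁺ X B λ b b∈ → pos (Fin.suc b) (Vec.there b∈)

restrictVector-⊕⁻ : (X : SignVector n) (B : Subset n) →
                    replicate _ ⊕ ≡ restrictVector X B → Positive X B
restrictVector-⊕⁻ (s ∷ X) (inside  ∷ B) eq Fin.zero    Vec.here       =
  sym (proj₁ (∷-injective eq))
restrictVector-⊕⁻ (s ∷ X) (inside  ∷ B) eq (Fin.suc b) (Vec.there b∈) =
  restrictVector-⊕⁻ X B (proj₂ (∷-injective eq)) b b∈
restrictVector-⊕⁻ (s ∷ X) (outside ∷ B) eq (Fin.suc b) (Vec.there b∈) =
  restrictVector-⊕⁻ X B eq b b∈

-- A vector without `𝟎` lies below itself only; this supplies the maximality half of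
-- `AcyclicFamily`.
⊕-maximal : (Y : SignVector n) → replicate n ⊕ ≼ Y → replicate n ⊕ ≡ Y
⊕-maximal {n} Y ⊕≼Y = lookup-extensional λ e → [ absurd e , id ]′ (⊕≼Y e)
  where
  absurd : ∀ e {B : Set} → lookup (replicate n ⊕) e ≡ 𝟎 → B
  absurd e eq with () ← trans (sym (lookup-replicate e ⊕)) eq

⊖≢⊕ : ⊖ ≢ ⊕
⊖≢⊕ ()

opposite-≡⊕ : ∀ {s} → opposite s ≡ ⊕ → s ≡ ⊖
opposite-≡⊕ {⊖} _ = refl

negativeOn : Subset n → SignVector n
negativeOn = Vec.map (if_then ⊖ else ⊕)

negativePart : SignVector n → Subset n
negativePart X = comprehension λ e → lookup X e ≟ˢ ⊖

negativeOn-injective : {A B : Subset n} → negativeOn A ≡ negativeOn B → A ≡ B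
negativeOn-injective {A = []}        {[]}        _  = refl
negativeOn-injective {A = true  ∷ A} {true  ∷ B} eq =
  cong (true ∷_) (negativeOn-injective (proj₂ (∷-injective eq)))
negativeOn-injective {A = false ∷ A} {false ∷ B} eq =
  cong (false ∷_) (negativeOn-injective (proj₂ (∷-injective eq)))
negativeOn-injective {A = true  ∷ A} {false ∷ B} ()
negativeOn-injective {A = false ∷ A} {true  ∷ B} ()

lookup-negativeOn-∈ : (A : Subset n) {e : Fin n} → e ∈ A → lookup (negativeOn A) e ≡ ⊖
lookup-negativeOn-∈ A {e} e∈A =
  trans (lookup-map e _ A) (cong (if_then ⊖ else ⊕) ([]=⇒lookup e∈A))

lookup-negativeOn-∉ : (A : Subset n) {e : Fin n} → e ∉ A → lookup (negativeOn A) e ≡ ⊕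
lookup-negativeOn-∉ A {e} e∉A = trans (lookup-map e _ A) (helper (lookup A e) refl)
  where
  helper : ∀ b → lookup A e ≡ b → (if b then ⊖ else ⊕) ≡ ⊕
  helper true  eq = contradiction (lookup⇒[]= e A eq) e∉A
  helper false _  = refl

lookup-negativeOn⇔∉ : (A : Subset n) {e : Fin n} → lookup (negativeOn A) e ≡ ⊕ ⇔ e ∉ A
lookup-negativeOn⇔∉ A = mk⇔
  (λ eq e∈A → ⊖≢⊕ (trans (sym (lookup-negativeOn-∈ A e∈A)) eq)) (lookup-negativeOn-∉ A)

≗-negativeOn : {A : Subset n} {X : SignVector n} →
               (∀ e → e ∈ A → lookup X e ≡ ⊖) → (∀ e → e ∉ A → lookup X e ≡ ⊕) →
               X ≡ negativeOn A
≗-negativeOn {A = A} on off = lookup-extensional λ e → case e (e Subset.∈? A)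
  where
  case : ∀ e → Dec (e ∈ A) → _
  case e (yes e∈A) = trans (on e e∈A) (sym (lookup-negativeOn-∈ A e∈A))
  case e (no  e∉A) = trans (off e e∉A) (sym (lookup-negativeOn-∉ A e∉A))

-- Convexity in oriented matroids

module _ (M : OrientedMatroid n) where

  -- A covector above `− T` is the negative of a covector above `T`, so maximality carries over.
  tope-− : ∀ {T} → Tope M T → Tope M (− T)
  tope-− {T} (cT , T-max) = symmetry M cT , λ Y cY −T≼Y →
    trans (cong −_ (T-max (− Y) (symmetry M cY) (flip Y −T≼Y))) (−-involutive Y)
    where
    flip-sign : ∀ {s t} → opposite s ≡ 𝟎 ⊎ opposite s ≡ t → s ≡ 𝟎 ⊎ s ≡ opposite t
    flip-sign {𝟎}     _           = inj₁ refl
    flip-sign {⊕} (inj₂ refl) = inj₂ refl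
    flip-sign {⊖} (inj₂ refl) = inj₂ refl
    flip : ∀ Y → − T ≼ Y → T ≼ − Y
    flip Y −T≼Y e rewrite lookup-map e opposite Y =
      flip-sign (subst (λ s → s ≡ 𝟎 ⊎ s ≡ lookup Y e) (lookup-map e opposite T) (−T≼Y e))

  -- By maximality `T ◦ X` equals `T` for every covector `X`. If `T` vanished at `e`, then every `X`
  -- would vanish there too, and `e` would be a loop.
  tope-nonzero : Simple M → ∀ {T} → Tope M T → ∀ e → lookup T e ≢ 𝟎
  tope-nonzero simple {T} (cT , T-max) e Te≡𝟎 = Simple.noLoops simple e λ X cX → begin
    lookup X e                 ≡⟨ cong (_◦ˢ lookup X e) Te≡𝟎 ⟨
    lookup T e ◦ˢ lookup X e   ≡⟨ lookup-zipWith _◦ˢ_ e T X ⟨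
    lookup (T ◦ X) e           ≡⟨ cong (λ Y → lookup Y e)
                                       (T-max (T ◦ X) (composition M cT cX) (≼-◦ X)) ⟨
    lookup T e                 ≡⟨ Te≡𝟎 ⟩
    𝟎                          ∎
    where
    open ≡-Reasoning
    ≼-◦ˢ : ∀ s t → s ≡ 𝟎 ⊎ s ≡ s ◦ˢ t
    ≼-◦ˢ ⊕ t = inj₂ refl
    ≼-◦ˢ ⊖ t = inj₂ refl
    ≼-◦ˢ 𝟎 t = inj₁ refl
    ≼-◦ : ∀ X → T ≼ T ◦ X
    ≼-◦ X f rewrite lookup-zipWith _◦ˢ_ f T X = ≼-◦ˢ (lookup T f) (lookup X f)

  positiveTope⇒acyclic : ∀ {T} → Tope M T → (∀ e → lookup T e ≡ ⊕) → Acyclic M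
  positiveTope⇒acyclic {T} T-tope T≗⊕ = subst (Tope M)
    (lookup-extensional λ e → trans (T≗⊕ e) (sym (lookup-replicate e ⊕))) T-tope

  acyclicSet⁺ : ∀ {F A} → Covector M F → Positive F A → AcyclicSet M A
  acyclicSet⁺ {F} {A} cF F⊕ = (F , cF , restrictVector-⊕⁺ F A F⊕) , λ Y _ → ⊕-maximal Y

  acyclicSet⁻ : ∀ {A} → AcyclicSet M A → ∃ λ F → Covector M F × Positive F A
  acyclicSet⁻ {A} ((F , cF , eq) , _) = F , cF , restrictVector-⊕⁻ F A eq

  inHull-mono : ∀ {A B} → A ⊆ B → ∀ {b} → InHull M A b → InHull M B b
  inHull-mono A⊆B h F cF F⊕ = h F cF λ a a∈A → F⊕ a (A⊆B a∈A)

  ∈-conv : ∀ {A} → AcyclicSet M A → ∀ {b} → b ∈ conv M A ⇔ InHull M A b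
  ∈-conv {A} acyclic {b} with acyclicSet? M A
  ... | yes _ = ∈-comprehension (inHull? M A) b
  ... | no ¬a = contradiction acyclic ¬a

  conv-positive : ∀ {F A} → Covector M F → Positive F A → Positive F (conv M A)
  conv-positive cF F⊕ b b∈ = to (∈-conv (acyclicSet⁺ cF F⊕)) b∈ _ cF F⊕

  ⊆-conv : ∀ {A} → A ⊆ conv M A
  ⊆-conv {A} {a} a∈A with acyclicSet? M A
  ... | yes _ = from (∈-comprehension (inHull? M A) a) λ F _ F⊕ → F⊕ a a∈A
  ... | no  _ = Subset.∈⊤

  -- Extreme points, anti-exchange and generation

  Extreme : Subset n → Pred (Fin n) 0ℓ
  Extreme A a = a ∈ A × a ∉ conv M (A - a)

  extreme? : ∀ A → Decidable (Extreme A)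
  extreme? A a = (a Subset.∈? A) ×-dec ¬? (a Subset.∈? conv M (A - a))

  -- Membership in `conv M (A - a)` unfolds to `InHull` only when `A - a` is acyclic; a covector
  -- positive on `A` witnesses this.
  ∈-ex⁺ : ∀ {A} → AcyclicSet M A → ∀ {a} → a ∈ A → ¬ InHull M (A - a) a → a ∈ ex M A
  ∈-ex⁺ {A} acyclic {a} a∈A ¬hull with acyclicSet? M A
  ... | no ¬a = contradiction acyclic ¬a
  ... | yes _ = from (∈-comprehension (extreme? A) a) (a∈A , ¬hull ∘ to (∈-conv A-a-acyclic))
    where
    A-a-acyclic : AcyclicSet M (A - a)
    A-a-acyclic = let F , cF , F⊕ = acyclicSet⁻ acyclic in
      acyclicSet⁺ cF λ b b∈ → F⊕ b (Subset.p─q⊆p A ⁅ a ⁆ b∈)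

  ex⊆ : ∀ {A} → AcyclicSet M A → ex M A ⊆ A
  ex⊆ {A} acyclic {a} a∈ with acyclicSet? M A
  ... | yes _ = proj₁ (to (∈-comprehension (extreme? A) a) a∈)
  ... | no ¬a = contradiction acyclic ¬a

  ex-nonacyclic : ∀ {A} → ¬ AcyclicSet M A → ex M A ≡ ⊤
  ex-nonacyclic {A} ¬acyclic with acyclicSet? M A
  ... | yes a = contradiction a ¬acyclic
  ... | no  _ = refl

  conv-nonacyclic : ∀ {A} → ¬ AcyclicSet M A → conv M A ≡ ⊤
  conv-nonacyclic {A} ¬acyclic with acyclicSet? M A
  ... | yes a = contradiction a ¬acyclic
  ... | no  _ = refl

  -- Generators are given by predicates here, so that `c ≡ t ⊎ C c` adjoins one element in the
  -- induction of `hull-grow`.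
  PositiveOn : Pred (Fin n) 0ℓ → Pred (SignVector n) 0ℓ
  PositiveOn C X = ∀ c → C c → lookup X c ≡ ⊕

  Hull : Pred (Fin n) 0ℓ → Pred (Fin n) 0ℓ
  Hull C b = ∀ F → Covector M F → PositiveOn C F → lookup F b ≡ ⊕

  -- If x and y each lie in the hull of C together with the other, then some
  -- covector Z is ⊕ on C and 𝟎 at x and y; composing Z with arbitrary covectors
  -- shows that x and y are parallel.
  antiExchange : Simple M → ∀ {C x y P} →
    Covector M P → PositiveOn C P → lookup P x ≡ ⊕ → x ≢ y →
    (∀ F → Covector M F → PositiveOn C F → lookup F x ≡ ⊕ ⇔ lookup F y ≡ ⊕) →
    Hull C x
  antiExchange simple {C} {x} {y} {P} cP P⊕ Px x≢y x⇔y G cG G⊕ = cases (lookup G x) refl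
    where
    ◦-at : ∀ X Y e {s} → lookup X e ≡ s → lookup (X ◦ Y) e ≡ s ◦ˢ lookup Y e
    ◦-at X Y e eq = trans (lookup-zipWith _◦ˢ_ e X Y) (cong (_◦ˢ lookup Y e) eq)

    ◦-positive : ∀ X Y → PositiveOn C X → PositiveOn C (X ◦ Y)
    ◦-positive X Y X⊕ c Cc = ◦-at X Y c (X⊕ c Cc)

    -- Whether a sign is `⊕` and whether its opposite is `⊕` together determine the sign.
    equal-signs : ∀ {s t} → s ≡ ⊕ ⇔ t ≡ ⊕ → opposite s ≡ ⊕ ⇔ opposite t ≡ ⊕ → s ≡ t
    equal-signs {⊕}     p q = sym (to p refl)
    equal-signs {⊖}     p q = sym (opposite-≡⊕ (to q refl))
    equal-signs {𝟎} {⊕} p q with () ← from p refl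
    equal-signs {𝟎} {⊖} p q with () ← from q refl
    equal-signs {𝟎} {𝟎} p q = refl

    both-zero : ∀ {Z} → Covector M Z → PositiveOn C Z →
                lookup Z x ≡ 𝟎 → lookup Z y ≡ 𝟎 → Parallel M x y
    both-zero {Z} cZ Z⊕ Zx Zy X cX = equal-signs (agree X cX)
      (subst (λ (s : Sign × Sign) → proj₁ s ≡ ⊕ ⇔ proj₂ s ≡ ⊕)
             (cong₂ _,_ (lookup-map x opposite X) (lookup-map y opposite X))
             (agree (− X) (symmetry M cX)))
      where
      agree : ∀ X → Covector M X → lookup X x ≡ ⊕ ⇔ lookup X y ≡ ⊕
      agree X cX = subst (λ (s : Sign × Sign) → proj₁ s ≡ ⊕ ⇔ proj₂ s ≡ ⊕)
        (cong₂ _,_ (◦-at Z X x Zx) (◦-at Z X y Zy))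
        (x⇔y (Z ◦ X) (composition M cZ cX) (◦-positive Z X Z⊕))

    zero-at-x : ∀ {Z} → Covector M Z → PositiveOn C Z → ¬ lookup Z x ≡ 𝟎
    zero-at-x {Z} cZ Z⊕ Zx = at-y (lookup Z y) refl
      where
      at-y : ∀ s → ¬ lookup Z y ≡ s
      at-y 𝟎 Zy = Simple.noParallel simple x y x≢y (both-zero cZ Z⊕ Zx Zy)
      at-y ⊕ Zy with () ← trans (sym Zx) (from (x⇔y Z cZ Z⊕) Zy)
      -- The composition `Z ◦ P` keeps `⊖` at `y` but takes the `⊕` of `P` at `x`, against the
      -- equivalence `x⇔y`.
      at-y ⊖ Zy with () ← trans (sym (◦-at Z P y Zy))
        (to (x⇔y (Z ◦ P) (composition M cZ cP) (◦-positive Z P Z⊕)) (trans (◦-at Z P x Zx) Px))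

    cases : ∀ s → lookup G x ≡ s → lookup G x ≡ ⊕
    cases ⊕ Gx = Gx
    cases 𝟎 Gx = contradiction Gx (zero-at-x cG G⊕)
    -- `P` and `G` are separated at `x` and at no element of `C`, so eliminating `x` gives a
    -- covector that is `𝟎` at `x` and still `⊕` on `C`.
    cases ⊖ Gx =
      let Z , cZ , Zx , Z≗ = elimination M cP cG x
            ((λ Px≡𝟎 → ⊕≢𝟎 (trans (sym Px) Px≡𝟎)) , trans Px (cong opposite (sym Gx)))
      in contradiction Zx (zero-at-x cZ λ c Cc → trans (Z≗ c (agree c Cc)) (◦-positive P G P⊕ c Cc))
      where
      ⊕≢𝟎 : ⊕ ≢ 𝟎
      ⊕≢𝟎 ()
      agree : ∀ c → C c → ¬ Separates P G c
      agree c Cc (_ , eq) with () ← trans (sym (P⊕ c Cc)) (trans eq (cong opposite (G⊕ c Cc)))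

  -- Anti-exchange iterated: L joins C one element at a time.
  hull-grow : Simple M → ∀ {s P} → Covector M P → lookup P s ≡ ⊕ →
    ∀ (L : List (Fin n)) {C} →
    ListAll.All (λ t → lookup P t ≡ ⊕ × t ≢ s × Hull (λ c → c ≡ s ⊎ C c) t) L →
    PositiveOn C P → Hull (λ c → c ∈ˡ L ⊎ C c) s → Hull C s
  hull-grow simple cP Ps [] _ P⊕ hull F cF F⊕ =
    hull F cF λ { c (inj₂ Cc) → F⊕ c Cc }
  hull-grow simple {s} {P} cP Ps (t ∷ L) {C} ((Pt , t≢s , ht) ∷ hL) P⊕ hull =
    -- Now `t` lies in the hull of `s` with `C` by assumption, and `s` in the hull of `t` with `C`
    -- by induction on `L`; anti-exchange removes `t`.
    λ F cF F⊕ → antiExchange simple cP P⊕ Ps (≢-sym t≢s) s⇔t F cF F⊕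
    where
    C+t : Pred (Fin n) 0ℓ
    C+t c = c ≡ t ⊎ C c
    hs : Hull C+t s
    hs = hull-grow simple cP Ps L
      (ListAll.map (λ (Pu , u≢s , hu) → Pu , u≢s , λ F cF F⊕ → hu F cF λ where
        c (inj₁ c≡s) → F⊕ c (inj₁ c≡s)
        c (inj₂ Cc)  → F⊕ c (inj₂ (inj₂ Cc))) hL)
      (λ { c (inj₁ refl) → Pt ; c (inj₂ Cc) → P⊕ c Cc })
      λ F cF F⊕ → hull F cF λ where
        c (inj₁ (here c≡t))  → F⊕ c (inj₂ (inj₁ c≡t))
        c (inj₁ (there c∈L)) → F⊕ c (inj₁ c∈L)
        c (inj₂ Cc)          → F⊕ c (inj₂ (inj₂ Cc))
    s⇔t : ∀ F → Covector M F → PositiveOn C F → lookup F s ≡ ⊕ ⇔ lookup F t ≡ ⊕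
    s⇔t F cF F⊕ = mk⇔
      (λ Fs → ht F cF λ { c (inj₁ refl) → Fs ; c (inj₂ Cc) → F⊕ c Cc })
      (λ Ft → hs F cF λ { c (inj₁ refl) → Ft ; c (inj₂ Cc) → F⊕ c Cc })

  -- Since `S` generates `A`, every element of `A - s` lies in the hull of `s` together with
  -- `S - s`. Listing `A - s` as `L`, `hull-grow` passes from redundancy of `s` in `A` to redundancy
  -- of `s` over `S - s`.
  inHull-descend : Simple M → ∀ {A S s} → AcyclicSet M A → S ⊆ A →
    (∀ a → a ∈ A → InHull M S a) → s ∈ A → InHull M (A - s) s → InHull M (S - s) s
  inHull-descend simple {A} {S} {s} acyclic S⊆A A⊆hull s∈A hull =
    let P , cP , P⊕ = acyclicSet⁻ acyclic in
    hull-grow simple cP (P⊕ s s∈A) (filter (Subset._∈? (A - s)) (allFin n))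
      (ListAll.tabulate λ {t} t∈L →
        let t∈A-s = proj₂ (∈-filter⁻ (Subset._∈? (A - s)) {xs = allFin n} t∈L)
            t∈A   = Subset.p─q⊆p A ⁅ s ⁆ t∈A-s
        in P⊕ t t∈A , x∈p-y⇒x≢y {p = A} t∈A-s ,
           λ F cF F⊕ → A⊆hull t t∈A F cF λ u u∈S → split F F⊕ u u∈S (u Fin.≟ s))
      (λ c c∈ → P⊕ c (S⊆A (Subset.p─q⊆p S ⁅ s ⁆ c∈)))
      (λ F cF F⊕ → hull F cF λ a a∈ →
        F⊕ a (inj₁ (∈-filter⁺ (Subset._∈? (A - s)) (∈-allFin a) a∈)))
    where
    split : ∀ F → PositiveOn (λ c → c ≡ s ⊎ c ∈ S - s) F →
            ∀ u → u ∈ S → Dec (u ≡ s) → lookup F u ≡ ⊕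
    split F F⊕ u u∈S (yes u≡s) = F⊕ u (inj₁ u≡s)
    split F F⊕ u u∈S (no  u≢s) = F⊕ u (inj₂ (Subset.x∈p∧x≢y⇒x∈p-y u∈S u≢s))

  -- Minkowski's theorem, proved by discarding redundant generators of A one at
  -- a time until only extreme points are left.
  ex-generates : Simple M → ∀ {A F} → AcyclicSet M A → Covector M F →
                 Positive F (ex M A) → Positive F A
  ex-generates simple {A} {F} acyclic cF F⊕ =
    reduce A (⊂-wellFounded A) id (λ a a∈A G _ G⊕ → G⊕ a a∈A)
    where
    reduce : ∀ S → Acc _⊂_ S → S ⊆ A → (∀ a → a ∈ A → InHull M S a) → Positive F A
    reduce S (acc rec) S⊆A A⊆hull
      with Fin.any? (λ s → (s Subset.∈? S) ×-dec inHull? M (S - s) s)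
    -- A covector positive on `S - s` is positive at the redundant `s` as well, so `S - s` still
    -- generates `A`.
    ... | yes (s , s∈S , redundant) = reduce (S - s) (rec (Subset.x∈p⇒p-x⊂p s∈S))
      (S⊆A ∘ Subset.p─q⊆p S ⁅ s ⁆)
      λ a a∈A G cG G⊕ → A⊆hull a a∈A G cG λ u u∈S → split G cG G⊕ u u∈S (u Fin.≟ s)
      where
      split : ∀ G → Covector M G → Positive G (S - s) → ∀ u → u ∈ S → Dec (u ≡ s) → lookup G u ≡ ⊕
      split G cG G⊕ u u∈S (yes refl) = redundant G cG G⊕
      split G cG G⊕ u u∈S (no  u≢s)  = G⊕ u (Subset.x∈p∧x≢y⇒x∈p-y u∈S u≢s)
    -- Each remaining `s` is extreme in `A`, for otherwise `inHull-descend` would make it redundant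
    -- in `S`.
    ... | no irredundant = λ a a∈A → A⊆hull a a∈A F cF λ s s∈S →
      F⊕ s (∈-ex⁺ acyclic (S⊆A s∈S) λ hull →
        irredundant (s , s∈S , inHull-descend simple acyclic S⊆A A⊆hull (S⊆A s∈S) hull))

  -- Convex sets with zero meet

  convex-∩ : ∀ {A B} → Convex M A → Convex M B → Convex M (A ∩ B)
  convex-∩ {A} {B} (acyclicA , convA) (acyclicB , convB) =
    acyclic , Subset.⊆-antisym conv⊆ ⊆-conv
    where
    acyclic : AcyclicSet M (A ∩ B)
    acyclic = let F , cF , F⊕ = acyclicSet⁻ acyclicA in
      acyclicSet⁺ cF λ b b∈ → F⊕ b (Subset.p∩q⊆p A B b∈)
    conv⊆ : conv M (A ∩ B) ⊆ A ∩ B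
    conv⊆ {b} b∈ = Subset.x∈p∩q⁺
      ( subst (b ∈_) convA (from (∈-conv acyclicA) (inHull-mono (Subset.p∩q⊆p A B) hull))
      , subst (b ∈_) convB (from (∈-conv acyclicB) (inHull-mono (Subset.p∩q⊆q A B) hull)))
      where hull = to (∈-conv acyclic) b∈

  -- The zero covector is vacuously positive on the empty set and is `⊕` nowhere, so it keeps every
  -- element out of the hull.
  convex-0̂ : Convex M 0̂
  convex-0̂ = acyclic , Subset.⊆-antisym conv⊆ Subset.⊥⊆
    where
    acyclic : AcyclicSet M 0̂
    acyclic = acyclicSet⁺ (zeroVector M) λ b b∈⊥ → contradiction b∈⊥ Subset.∉⊥
    conv⊆ : conv M 0̂ ⊆ 0̂
    conv⊆ {b} b∈ with () ← trans (sym (lookup-replicate b 𝟎))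
      (to (∈-conv acyclic) b∈ _ (zeroVector M) λ c c∈⊥ → contradiction c∈⊥ Subset.∉⊥)

  Disjoint : Subset n → Subset n → Set
  Disjoint A B = ∀ e → e ∈ A → e ∉ B

  -- `A ∩ B` is itself convex, hence a lower bound in `L̂`; if the meet is `0̂`, this intersection
  -- is empty.
  isMeet-0̂⇔disjoint : ∀ {A B} → Convex M A → Convex M B → IsMeet M A B 0̂ ⇔ Disjoint A B
  isMeet-0̂⇔disjoint {A} {B} convexA convexB = mk⇔
    (λ (_ , _ , _ , greatest) e e∈A e∈B → Subset.∉⊥
      (greatest (A ∩ B) (inj₁ (convex-∩ convexA convexB))
        (Subset.p∩q⊆p A B) (Subset.p∩q⊆q A B) (Subset.x∈p∩q⁺ (e∈A , e∈B))))
    (λ disjoint → inj₁ convex-0̂ , (λ {_} → Subset.⊥⊆) , (λ {_} → Subset.⊥⊆) ,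
      λ _ _ D⊆A D⊆B {e} e∈D → contradiction (D⊆B e∈D) (disjoint e (D⊆A e∈D)))

  -- Counting

  topeSet-resp-⇄ : {v w : Vec (SignVector n) k} → v ⇄ w → TopeSet M v → TopeSet M w
  topeSet-resp-⇄ s (topes , v!) = All-resp-⇄ s topes , Unique-resp-⇄ s v!

  topeCommittee-resp-⇄ : {v w : Vec (SignVector n) k} →
                         v ⇄ w → TopeCommittee M v → TopeCommittee M w
  topeCommittee-resp-⇄ {k} s (v-topes , majority) = topeSet-resp-⇄ s v-topes ,
    λ e → subst (λ c → k < 2 * c) (count-resp-⇄ (𝒯⁺? M e) s) (majority e)

  committee-symmetric : Symmetric (𝟙 (topeCommittee? M {k}))
  committee-symmetric s = 𝟙-cong (topeCommittee? M) (topeCommittee? M)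
    (mk⇔ (topeCommittee-resp-⇄ s) (topeCommittee-resp-⇄ (⇄-sym s)))

  -- Vectors with distinct negatives are distinct, and negating a tope gives a tope; this recovers
  -- `TopeSet M v` from the negated listing.
  topeAntiCommittee⇔ : {v : Vec (SignVector n) k} →
                       TopeAntiCommittee M v ⇔ TopeCommittee M (Vec.map −_ v)
  topeAntiCommittee⇔ {v = v} = mk⇔ proj₂ λ committee →
    (topes (proj₁ committee) , unmap (proj₂ (proj₁ committee))) , committee
    where
    topes : TopeSet M (Vec.map −_ v) → VecAll.All (Tope M) v
    topes (−v-topes , _) = VecAll.map
      (λ {T} tope → subst (Tope M) (−-involutive T) (tope-− tope)) (VecAll.map⁻ −v-topes)
    unmap : {v : Vec (SignVector n) k} → Unique (Vec.map −_ v) → Unique v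
    unmap {v = []}    _            = []
    unmap {v = _ ∷ _} (x∉v ∷ v!) =
      VecAll.map (λ −x≢−y x≡y → −x≢−y (cong −_ x≡y)) (VecAll.map⁻ x∉v) ∷ unmap v!

  #𝐊≡combSum : ∀ k → #𝐊 M k ≡ combSum (𝟙 (topeCommittee? M {k})) (signVectors n)
  #𝐊≡combSum k = length-filter≡sum (topeCommittee? M) (combinations k (signVectors n))

  #𝐊≡#𝐀 : ∀ k → #𝐊 M k ≡ #𝐀 M k
  #𝐊≡#𝐀 k = begin
    #𝐊 M k
      ≡⟨ #𝐊≡combSum k ⟩
    combSum 𝟙K (signVectors n)
      ≡⟨ combSum-↭ {f = 𝟙K} committee-symmetric (map−-signVectors-↭ n) ⟨
    combSum 𝟙K (map −_ (signVectors n))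
      ≡⟨ combSum-map 𝟙K −_ (signVectors n) ⟩
    combSum (𝟙K ∘ Vec.map −_) (signVectors n)
      ≡⟨ cong sum (map-cong
           (λ v → 𝟙-cong (topeAntiCommittee? M) (topeCommittee? M) (topeAntiCommittee⇔ {v = v}))
           (combinations k (signVectors n))) ⟨
    combSum (𝟙 (topeAntiCommittee? M {k})) (signVectors n)
      ≡⟨ length-filter≡sum (topeAntiCommittee? M) (combinations k (signVectors n)) ⟨
    #𝐀 M k
      ∎
    where
    open ≡-Reasoning
    𝟙K : Vec (SignVector n) k → ℕ
    𝟙K = 𝟙 (topeCommittee? M)

  -- Factors of the product and the topes they count

  Factor : Subset n → Pred (SignVector n) 0ℓ
  Factor A T = 𝒯⁺⋂ M (ex M A) T × −ᶠ (𝒯⁺⋂ M (ex M (conv M (∁ A)))) T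

  factor? : ∀ A → Decidable (Factor A)
  factor? A = 𝒯⁺⋂? M (ex M A) ∩? −ᶠ? (𝒯⁺⋂? M (ex M (conv M (∁ A))))

  factor : Subset n → ℕ
  factor A = card (factor? A)

  module _ (simple : Simple M) (¬acyclic : ¬ Acyclic M) where

    -- This keeps negative parts of topes away from `1̂` and puts `ex M ⊤` under the convention
    -- `ex(E) := E`.
    ¬acyclicSet-⊤ : ¬ AcyclicSet M ⊤
    ¬acyclicSet-⊤ acyclic =
      let F , cF , F⊕ = acyclicSet⁻ acyclic in
      ¬acyclic (subst (Covector M)
        (lookup-extensional λ e → trans (F⊕ e Subset.∈⊤) (sym (lookup-replicate e ⊕))) cF ,
        λ Y _ → ⊕-maximal Y)

    properConvex : ∀ {A} → L̂-proper M A → Convex M A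
    properConvex (inj₁ convex , _)         = convex
    properConvex (inj₂ A≡1̂ , _ , A≢1̂) = contradiction A≡1̂ A≢1̂

    tope≡negativeOn : ∀ {T} → Tope M T → T ≡ negativeOn (negativePart T)
    tope≡negativeOn {T} tope = ≗-negativeOn
      (λ e → to (∈-comprehension (λ f → lookup T f ≟ˢ ⊖) e))
      (λ e e∉ → sign (tope-nonzero simple tope e)
        (e∉ ∘ from (∈-comprehension (λ f → lookup T f ≟ˢ ⊖) e)))
      where
      sign : ∀ {s} → s ≢ 𝟎 → s ≢ ⊖ → s ≡ ⊕
      sign {⊕} _ _ = refl
      sign {⊖} _ s≢⊖ = contradiction refl s≢⊖
      sign {𝟎} s≢𝟎 _ = contradiction refl s≢𝟎

    −negativeOn-positive : (A : Subset n) → Positive (− negativeOn A) A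
    −negativeOn-positive A a a∈A =
      trans (lookup-map a opposite (negativeOn A)) (cong opposite (lookup-negativeOn-∈ A a∈A))

    negativeOn-positive : (A : Subset n) → Positive (negativeOn A) (∁ A)
    negativeOn-positive A a a∈∁A = lookup-negativeOn-∉ A (Subset.x∈∁p⇒x∉p a∈∁A)

    -- The covector `− negativeOn A` is positive exactly on `A`, which gives both acyclicity and
    -- convexity. An empty `A` would yield the positive tope, and `A` equal to the ground set would
    -- make that set acyclic.
    tope⇒proper : ∀ {A} → Tope M (negativeOn A) → L̂-proper M A
    tope⇒proper {A} tope = inj₁ (acyclic , Subset.⊆-antisym conv⊆ ⊆-conv) ,
      (λ { refl → ¬acyclic (positiveTope⇒acyclic tope λ e →
        lookup-negativeOn-∉ (0̂ {n}) Subset.∉⊥) }) ,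
      (λ { refl → ¬acyclicSet-⊤ acyclic })
      where
      c−T : Covector M (− negativeOn A)
      c−T = symmetry M (proj₁ tope)
      acyclic : AcyclicSet M A
      acyclic = acyclicSet⁺ c−T (−negativeOn-positive A)
      conv⊆ : conv M A ⊆ A
      conv⊆ {b} b∈ = decidable-stable (b Subset.∈? A) λ b∉A →
        ⊖≢⊕ (trans (sym (trans (lookup-map b opposite (negativeOn A))
                               (cong opposite (lookup-negativeOn-∉ A b∉A))))
                   (conv-positive c−T (−negativeOn-positive A) b b∈))

    -- Extreme points generate, so the first condition fixes `T` on `A` and the second fixes its
    -- negative `F` off `A`.
    factor⇒tope : ∀ {A T} → L̂-proper M A → Factor A T → Tope M T × T ≡ − negativeOn A
    factor⇒tope {A} proper ((tope , T⊕) , F , (F-tope , F⊕) , refl) =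
      tope , cong −_ (≗-negativeOn F⊖ F-positive)
      where
      F⊖ : ∀ e → e ∈ A → lookup F e ≡ ⊖
      F⊖ e e∈A = opposite-≡⊕ (trans (sym (lookup-map e opposite F))
        (ex-generates simple (proj₁ (properConvex proper)) (proj₁ tope)
          (λ b b∈ → proj₂ (T⊕ b b∈)) e e∈A))
      on-complement : Dec (AcyclicSet M (∁ A)) → Positive F (∁ A)
      -- A covector positive on `∁ A` is positive on its hull, so the hull is acyclic and is
      -- generated by its extreme points.
      on-complement (yes acyclic) e e∈ =
        let P , cP , P⊕ = acyclicSet⁻ acyclic in
        ex-generates simple (acyclicSet⁺ cP (conv-positive cP P⊕)) (proj₁ F-tope)
          (λ b b∈ → proj₂ (F⊕ b b∈)) e (⊆-conv e∈)
      -- Both conventions apply: the hull is the whole ground set and so is its `ex`. Then `F` would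
      -- be the positive tope.
      on-complement (no ¬∁-acyclic) = ⊥-elim (¬acyclic (positiveTope⇒acyclic F-tope λ e →
        proj₂ (F⊕ e (subst (e ∈_) (sym ex≡⊤) Subset.∈⊤))))
        where
        ex≡⊤ : ex M (conv M (∁ A)) ≡ ⊤
        ex≡⊤ = trans (cong (ex M) (conv-nonacyclic ¬∁-acyclic)) (ex-nonacyclic ¬acyclicSet-⊤)
      F-positive : ∀ e → e ∉ A → lookup F e ≡ ⊕
      F-positive e e∉A = on-complement (acyclicSet? M (∁ A)) e (Subset.x∉p⇒x∈∁p e∉A)

    tope⇒factor : ∀ {A} → Tope M (negativeOn A) → Factor A (− negativeOn A)
    tope⇒factor {A} tope =
      positive-on-ex (− negativeOn A) A (tope-− tope) (−negativeOn-positive A) ,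
      negativeOn A ,
      positive-on-ex (negativeOn A) (conv M (∁ A)) tope
        (conv-positive (proj₁ tope) (negativeOn-positive A)) ,
      refl
      where
      positive-on-ex : ∀ T B → Tope M T → Positive T B → 𝒯⁺⋂ M (ex M B) T
      positive-on-ex T B tope T⊕ =
        tope , λ b b∈ → tope , T⊕ b (ex⊆ (acyclicSet⁺ (proj₁ tope) T⊕) b∈)

    factor≢0⇒tope : ∀ {A} → L̂-proper M A → factor A ≢ 0 → Tope M (negativeOn A)
    factor≢0⇒tope {A} proper ≢0 =
      let T , fT = card≢0 (factor? A) ≢0
          tope , T≡ = factor⇒tope proper fT
      in subst (Tope M) (trans (cong −_ T≡) (−-involutive (negativeOn A))) (tope-− tope)

    tope⇒factor≡1 : ∀ {A} → Tope M (negativeOn A) → factor A ≡ 1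
    tope⇒factor≡1 {A} tope = card-singleton (factor? A) (tope⇒factor {A} tope)
      λ T fT → proj₂ (factor⇒tope {A} {T} (tope⇒proper {A} tope) fT)

    -- By `count-majority`, a majority at `e` means that of any two of the three sets one misses
    -- `e`; over all `e` this is pairwise disjointness.
    committee⇔meetsAreZero :
      ∀ {v} → VecAll.All (Tope M ∘ negativeOn) v →
      TopeCommittee M (Vec.map negativeOn v) ⇔ MeetsAreZero M v
    committee⇔meetsAreZero {A ∷ B ∷ C ∷ []} (tA VecAll.∷ tB VecAll.∷ tC VecAll.∷ VecAll.[]) = mk⇔
      (λ (_ , majority) →
        let majority′ e = to (majority⇔ e) (majority e) in
        from (meet tA tB) (disjoint (proj₁ ∘ majority′)) ,
        from (meet tA tC) (disjoint (proj₁ ∘ proj₂ ∘ majority′)) ,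
        from (meet tB tC) (disjoint (proj₂ ∘ proj₂ ∘ majority′)))
      (λ (mAB , mAC , mBC) →
        let dAB = to (meet tA tB) mAB
            dAC = to (meet tA tC) mAC
            dBC = to (meet tB tC) mBC
        in ((tA VecAll.∷ tB VecAll.∷ tC VecAll.∷ VecAll.[]) ,
            (distinct tA dAB VecAll.∷ distinct tA dAC VecAll.∷ VecAll.[]) ∷
            (distinct tB dBC VecAll.∷ VecAll.[]) ∷ VecAll.[] ∷ []) ,
           λ e → from (majority⇔ e)
             (cover tA tB dAB e , cover tA tC dAC e , cover tB tC dBC e))
      where
      majority⇔ = λ e →
        count-majority (𝒯⁺? M e) (negativeOn A) (negativeOn B) (negativeOn C)

      meet : ∀ {A B} → Tope M (negativeOn A) → Tope M (negativeOn B) →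
             IsMeet M A B 0̂ ⇔ Disjoint A B
      meet tA tB = isMeet-0̂⇔disjoint
        (properConvex (tope⇒proper tA)) (properConvex (tope⇒proper tB))

      disjoint : ∀ {A B} → (∀ e → 𝒯⁺ M e (negativeOn A) ⊎ 𝒯⁺ M e (negativeOn B)) → Disjoint A B
      disjoint {A} {B} cov e e∈A e∈B = [ (λ (_ , eq) → to (lookup-negativeOn⇔∉ A) eq e∈A)
                               , (λ (_ , eq) → to (lookup-negativeOn⇔∉ B) eq e∈B) ]′ (cov e)

      cover : ∀ {A B} → Tope M (negativeOn A) → Tope M (negativeOn B) → Disjoint A B →
              ∀ e → 𝒯⁺ M e (negativeOn A) ⊎ 𝒯⁺ M e (negativeOn B)
      cover {A} {B} tA tB A∥B e with e Subset.∈? A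
      ... | yes e∈A = inj₂ (tB , lookup-negativeOn-∉ B (A∥B e e∈A))
      ... | no  e∉A = inj₁ (tA , lookup-negativeOn-∉ A e∉A)

      -- A set disjoint from itself is empty, but the negative part of a tope is not.
      distinct : ∀ {A B} → Tope M (negativeOn A) → Disjoint A B → negativeOn A ≢ negativeOn B
      distinct {A} tA A∥B eq with refl ← negativeOn-injective eq =
        proj₁ (proj₂ (tope⇒proper tA)) (Subset.Empty-unique λ (e , e∈A) → A∥B e e∈A e∈A)

    -- From the weighted sum over triples to the committee count

    module _ (weight : Subset n → ℕ)
             (weight≢0⇒tope : ∀ {A} → L̂-proper M A → weight A ≢ 0 → Tope M (negativeOn A))
             (tope⇒weight≡1 : ∀ {A} → Tope M (negativeOn A) → weight A ≡ 1) where

      properSubsets : List (Subset n)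
      properSubsets = filter (l̂-proper? M) (subsets n)

      weight≢0? : Decidable (λ A → weight A ≢ 0)
      weight≢0? A = ¬? (weight A ℕ.≟ 0)

      -- Selection by nonzero weight matches the vanishing of products, as `combSum-filter`
      -- requires; the two assumptions on `weight` make the selected sets the negative parts of
      -- topes.
      negativeParts : List (Subset n)
      negativeParts = filter weight≢0? properSubsets

      ∈-negativeParts : ∀ A → A ∈ˡ negativeParts ⇔ Tope M (negativeOn A)
      ∈-negativeParts A = mk⇔
        (λ A∈ → let A∈′ , ≢0 = ∈-filter⁻ weight≢0? {xs = properSubsets} A∈ in
          weight≢0⇒tope (proj₂ (∈-filter⁻ (l̂-proper? M) {xs = subsets n} A∈′)) ≢0)
        (λ tope → ∈-filter⁺ weight≢0?
          (∈-filter⁺ (l̂-proper? M) (∈-subsets A) (tope⇒proper tope))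
          (λ ≡0 → 0≢1 (trans (sym ≡0) (tope⇒weight≡1 tope))))
        where
        0≢1 : 0 ≢ 1
        0≢1 ()

      -- A tope has no `𝟎`, so its negative part determines it; this bijection carries the count
      -- from topes to subsets.
      map-negativeOn-↭ : map negativeOn negativeParts ↭ filter (tope? M) (signVectors n)
      map-negativeOn-↭ = unique∧≋⇒↭
        (ListUnique.map⁺ negativeOn-injective
          (ListUnique.filter⁺ weight≢0? (ListUnique.filter⁺ (l̂-proper? M) (subsets-unique n))))
        (ListUnique.filter⁺ (tope? M) (signVectors-unique n))
        λ T → mk⇔
          (λ T∈ → let A , A∈ , T≡ = ∈-map⁻ negativeOn T∈ in
            ∈-filter⁺ (tope? M) (∈-signVectors T)
              (subst (Tope M) (sym T≡) (to (∈-negativeParts A) A∈)))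
          (λ T∈ → let tope = proj₂ (∈-filter⁻ (tope? M) {xs = signVectors n} T∈)
                      T≡   = tope≡negativeOn tope
                  in subst (_∈ˡ map negativeOn negativeParts) (sym T≡)
                       (∈-map⁺ negativeOn
                         (from (∈-negativeParts (negativePart T)) (subst (Tope M) T≡ tope))))

      -- The meet condition becomes a 0-1 factor, so that the sum over admissible triples runs over
      -- all triples of proper elements of `L̂`.
      term : Vec (Subset n) 3 → ℕ
      term v = 𝟙 (meetsAreZero? M) v * product (map weight (toList v))

      product-weight≡0 : (v : Vec (Subset n) k) → ¬ VecAll.All (λ A → weight A ≢ 0) v →
                         product (map weight (toList v)) ≡ 0
      product-weight≡0 []      ¬all = contradiction VecAll.[] ¬all
      product-weight≡0 (A ∷ v) ¬all with weight A ℕ.≟ 0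
      ... | yes ≡0 = cong (_* product (map weight (toList v))) ≡0
      ... | no  ≢0 = trans
        (cong (weight A *_) (product-weight≡0 v (λ all → ¬all (≢0 VecAll.∷ all))))
          (ℕ.*-zeroʳ (weight A))

      product-weight≡1 : (v : Vec (Subset n) k) → VecAll.All (Tope M ∘ negativeOn) v →
                         product (map weight (toList v)) ≡ 1
      product-weight≡1 []      VecAll.[]           = refl
      product-weight≡1 (A ∷ v) (tope VecAll.∷ topes) =
        cong₂ _*_ (tope⇒weight≡1 tope) (product-weight≡1 v topes)

      -- The range shrinks from all sign vectors to topes, moves to their negative parts, and widens
      -- to all of `properSubsets`; shrinking and widening affect only terms equal to 0.
      #𝐊≡sum : #𝐊 M 3 ≡
        sum (map (λ v → product (map weight (toList v))) (admissibleTriples M))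
      #𝐊≡sum = begin
        #𝐊 M 3
          ≡⟨ #𝐊≡combSum 3 ⟩
        combSum 𝟙K (signVectors n)
          ≡⟨ combSum-filter (tope? M) {f = 𝟙K} not-topes (signVectors n) ⟨
        combSum 𝟙K (filter (tope? M) (signVectors n))
          ≡⟨ combSum-↭ {f = 𝟙K} committee-symmetric map-negativeOn-↭ ⟨
        combSum 𝟙K (map negativeOn negativeParts)
          ≡⟨ combSum-map 𝟙K negativeOn negativeParts ⟩
        combSum (𝟙K ∘ Vec.map negativeOn) negativeParts
          ≡⟨ combSum-cong {f = 𝟙K ∘ Vec.map negativeOn} {g = term} committee≡term
               (ListAll.tabulate λ {A} → to (∈-negativeParts A)) ⟩
        combSum term negativeParts
          ≡⟨ combSum-filter weight≢0? {f = term} term≡0 properSubsets ⟩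
        combSum term properSubsets
          ≡⟨ sum-map-filter (meetsAreZero? M) (λ v → product (map weight (toList v)))
               (combinations 3 properSubsets) ⟨
        sum (map (λ v → product (map weight (toList v))) (admissibleTriples M))
          ∎
        where
        open ≡-Reasoning
        𝟙K : Vec (SignVector n) 3 → ℕ
        𝟙K = 𝟙 (topeCommittee? M)
        not-topes : ∀ v → ¬ VecAll.All (Tope M) v → 𝟙K v ≡ 0
        not-topes v ¬topes = cong (if_then 1 else 0)
          (dec-false (topeCommittee? M v) (¬topes ∘ proj₁ ∘ proj₁))
        term≡0 : ∀ v → ¬ VecAll.All (λ A → weight A ≢ 0) v → term v ≡ 0
        term≡0 v ¬all = trans (cong (𝟙 (meetsAreZero? M) v *_) (product-weight≡0 v ¬all))
                              (ℕ.*-zeroʳ (𝟙 (meetsAreZero? M) v))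
        committee≡term : ∀ v → VecAll.All (Tope M ∘ negativeOn) v →
                         𝟙K (Vec.map negativeOn v) ≡ term v
        committee≡term v topes = begin
          𝟙K (Vec.map negativeOn v)
            ≡⟨ 𝟙-cong (topeCommittee? M) (meetsAreZero? M) (committee⇔meetsAreZero topes) ⟩
          𝟙 (meetsAreZero? M) v
            ≡⟨ ℕ.*-identityʳ _ ⟨
          𝟙 (meetsAreZero? M) v * 1
            ≡⟨ cong (𝟙 (meetsAreZero? M) v *_) (product-weight≡1 v topes) ⟨
          term v
            ∎

mainTheorem2 : ∀ (n : ℕ) (M : OrientedMatroid n) → Simple M → ¬ Acyclic M →
    #𝐊 M 3 ≡ #𝐀 M 3 ×
    #𝐀 M 3 ≡
    sum (map (λ triple →
    product (map (λ A → card (𝒯⁺⋂? M (ex M A) ∩?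
    −ᶠ? (𝒯⁺⋂? M (ex M (conv M (∁ A))))))
    (toList triple)))
    (admissibleTriples M))
mainTheorem2 n M simple ¬acyclic =
  #𝐊≡#𝐀 M 3 , trans (sym (#𝐊≡#𝐀 M 3))
    (#𝐊≡sum M simple ¬acyclic (factor M)
      (λ {A} → factor≢0⇒tope M simple ¬acyclic {A})
      (λ {A} → tope⇒factor≡1 M simple ¬acyclic {A}))
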